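{- Let $K\subset\mathbb{R}^d$ be a strictly convex polyhedral cone with set of generators $W=\{w_1,\dots,w_n\}$, $n\ge d$. Suppose the generators $w_1,\dots,w_n$ of $K$ are in general positions such that no $d$-element subset of them is linearly dependent; or equivalently, $K$ is the cone over a simplicial polytope of dimension $d-1$. Then the $\binom{n}{d-1}\times\binom{n-1}{d-1}$ matrix $A_K$, whose rows are the vectors $\nu_{n-d}(D^*)$ for $D$ ranging over all $(d-1)$-element subsets of $W$, has full rank.
   Context: $\langle\cdot,\cdot\rangle$ is the standard inner product on $\mathbb{R}^d$. The cone with apex $v$ and generators $w_1,\dots,w_n$ is $K=\{v+t_1w_1+\dots+t_nw_n : t_1,\dots,t_n>0\}$; strictly convex means that $K$ does not contain a line. A simplicial polytope is a convex polytope all of whose proper faces are simplices. Generalized cross product: for $x_1,\dots,x_{d-1}\in\mathbb{R}^d$, $[x_1,\dots,x_{d-1}]\in\mathbb{R}^d$ is the unique vector with $\langle[x_1,\dots,x_{d-1}],x\rangle=\det(x_1,\dots,x_{d-1},x)$ for all $x\in\mathbb{R}^d$. For a $(d-1)$-element subset $D=\{w_{i_1},\dots,w_{i_{d-1}}\}$ of $W$ (a "diagonal" of $K$), with a fixed ordering of its elements, $D^*:=[w_{i_1},\dots,w_{i_{d-1}}]$. Veronese map: $\nu_k:\mathbb{R}^d\to\mathbb{R}^{\binom{d+k-1}{d-1}}$ sends $x$ to the vector of values at $x$ of all monomials $x_1^{e_1}\cdots x_d^{e_d}$ with $e_i\ge0$ integers and $e_1+\dots+e_d=k$ (in a fixed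 order). The matrix $A_K$ is the coefficient matrix of the linear system expressing the values at the points $D^*$ of an unknown homogeneous polynomial of degree $n-d$ in $d$ variables in terms of its coefficients. -}

module Defs where

open import Algebra.Bundles using (CommutativeRing)
open import Data.Fin.Base using (Fin; zero; suc; toℕ; fromℕ; punchIn)
open import Data.Fin.Properties using (+↔⊎)
open import Data.Fin.Subset using (Subset; inside; outside; ∣_∣; _∈_)
open import Data.Nat.Base as ℕ using (ℕ; zero; suc)
import Data.Nat.Properties as ℕ
open import Data.Nat.Combinatorics using (_C_; nCn≡1; nCk+nC[k+1]≡[n+1]C[k+1])
open import Data.Product.Base using (Σ; ∃; ∃-syntax; _×_; _,_; proj₁) renaming (map to map×)
open import Data.Sum.Base using (_⊎_; inj₁; inj₂)
open import Data.Sum.Function.Propositional using (_⊎-↔_)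
open import Data.Product using (∃!)
open import Data.Vec.Base as Vec using (Vec; []; _∷_; here; there)
open import Data.Vec.Functional using (Vector; insertAt; removeAt)
open import Data.Vec.Functional.Properties using (insertAt-lookup; insertAt-punchIn)
open import Function.Base using (_∘_)
open import Function.Bundles using (_↔_; _↣_; Inverse; Injection; mk↔ₛ′)
open import Function.Construct.Composition using (_↔-∘_)
open import Level using (0ℓ)
open import Relation.Binary.Core using (Rel)
open import Relation.Binary.Structures using (IsStrictTotalOrder)
import Relation.Binary.PropositionalEquality as ≡
open ≡ using (_≡_)
open import Relation.Nullary using (¬_)
open import Relation.Unary using (Pred)

-- The real numbers, given axiomatically as a Dedekind-complete ordered field
-- (unique up to isomorphism). Comparison is trichotomous, as it is classically.
record Reals : Set₁ where
  field
    commutativeRing : CommutativeRing 0ℓ 0ℓ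

  open CommutativeRing commutativeRing public

  infix 4 _<_
  field
    _<_                : Rel Carrier 0ℓ
    isStrictTotalOrder : IsStrictTotalOrder _≈_ _<_
    0≉1                : 0# ≉ 1#
    inverse            : ∀ x → x ≉ 0# → ∃[ y ] x * y ≈ 1#
    +-monoˡ-<          : ∀ z {x y} → x < y → x + z < y + z
    *-pos              : ∀ {x y} → 0# < x → 0# < y → 0# < x * y

  UpperBound : Pred Carrier 0ℓ → Pred Carrier 0ℓ
  UpperBound P b = ∀ x → P x → ¬ (b < x)

  field
    supremum : (P : Pred Carrier 0ℓ) → ∃ P → ∃ (UpperBound P) →
               ∃[ s ] UpperBound P s × (∀ b → UpperBound P b → ¬ (b < s))

SubsetOfSize : ℕ → ℕ → Set
SubsetOfSize n k = Σ (Subset n) λ S → ∣ S ∣ ≡ k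

-- An ordering of the elements of S; its existence forces ∣ S ∣ ≡ k.
Ordering : ∀ {n} → ℕ → Subset n → Set
Ordering k S = Fin k ↔ ∃ (_∈ S)

-- Exponent vectors of the monomials of degree k in d variables.
Exponents : ℕ → ℕ → Set
Exponents d k = Σ (Vec ℕ d) λ e → Vec.sum e ≡ k

-- orderSubset, enumerateSubsets and enumerateExponents show that orderings of
-- subsets, and enumerations of these index sets of binomial size, always exist.

private
  Fin-cong : ∀ {m n} → m ≡ n → Fin m ↔ Fin n
  Fin-cong ≡.refl = mk↔ₛ′ (λ i → i) (λ i → i) (λ _ → ≡.refl) (λ _ → ≡.refl)

  size-≡ : ∀ {A : Set} {f : A → ℕ} {k} {x y : Σ A λ a → f a ≡ k} →
           proj₁ x ≡ proj₁ y → x ≡ y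
  size-≡ {x = _ , p} {y = _ , q} ≡.refl = ≡.cong (_ ,_) (ℕ.≡-irrelevant p q)

orderSubset : ∀ {n} (S : Subset n) → Ordering ∣ S ∣ S
orderSubset {zero}  []            = mk↔ₛ′ (λ ()) (λ ()) (λ ()) (λ ())
orderSubset {suc n} (outside ∷ S) = mk↔ₛ′ to from to∘from (strictlyInverseʳ)
  where
  open Inverse (orderSubset S) using (strictlyInverseˡ; strictlyInverseʳ) renaming (to to f; from to g)
  to : Fin ∣ S ∣ → ∃ (_∈ outside ∷ S)
  to k = map× suc there (f k)
  from : ∃ (_∈ outside ∷ S) → Fin ∣ S ∣
  from (suc i , there i∈S) = g (i , i∈S)
  to∘from : ∀ x → to (from x) ≡ x
  to∘from (suc i , there i∈S) = ≡.cong (map× suc there) (strictlyInverseˡ (i , i∈S))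
orderSubset {suc n} (inside ∷ S) = mk↔ₛ′ to from to∘from from∘to
  where
  open Inverse (orderSubset S) using (strictlyInverseˡ; strictlyInverseʳ) renaming (to to f; from to g)
  to : Fin (suc ∣ S ∣) → ∃ (_∈ inside ∷ S)
  to zero    = zero , here
  to (suc k) = map× suc there (f k)
  from : ∃ (_∈ inside ∷ S) → Fin (suc ∣ S ∣)
  from (zero  , here)      = zero
  from (suc i , there i∈S) = suc (g (i , i∈S))
  to∘from : ∀ x → to (from x) ≡ x
  to∘from (zero  , here)      = ≡.refl
  to∘from (suc i , there i∈S) = ≡.cong (map× suc there) (strictlyInverseˡ (i , i∈S))
  from∘to : ∀ k → from (to k) ≡ k
  from∘to zero    = ≡.refl
  from∘to (suc k) = ≡.cong suc (strictlyInverseʳ k)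

private
  splitSubset₀ : ∀ {n} → SubsetOfSize n 0 ↔ SubsetOfSize (suc n) 0
  splitSubset₀ {n} = mk↔ₛ′ to from to∘from (λ _ → ≡.refl)
    where
    to : SubsetOfSize n 0 → SubsetOfSize (suc n) 0
    to (S , p) = outside ∷ S , p
    from : SubsetOfSize (suc n) 0 → SubsetOfSize n 0
    from (outside ∷ S , p) = S , p
    to∘from : ∀ S → to (from S) ≡ S
    to∘from (outside ∷ S , p) = ≡.refl

  splitSubset : ∀ {n k} → (SubsetOfSize n k ⊎ SubsetOfSize n (suc k)) ↔ SubsetOfSize (suc n) (suc k)
  splitSubset {n} {k} = mk↔ₛ′ to from to∘from from∘to
    where
    to : SubsetOfSize n k ⊎ SubsetOfSize n (suc k) → SubsetOfSize (suc n) (suc k)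
    to (inj₁ (S , p)) = inside ∷ S , ≡.cong suc p
    to (inj₂ (S , p)) = outside ∷ S , p
    from : SubsetOfSize (suc n) (suc k) → SubsetOfSize n k ⊎ SubsetOfSize n (suc k)
    from (inside  ∷ S , p) = inj₁ (S , ℕ.suc-injective p)
    from (outside ∷ S , p) = inj₂ (S , p)
    to∘from : ∀ S → to (from S) ≡ S
    to∘from (inside  ∷ S , p) = size-≡ {f = ∣_∣} ≡.refl
    to∘from (outside ∷ S , p) = ≡.refl
    from∘to : ∀ S → from (to S) ≡ S
    from∘to (inj₁ (S , p)) = ≡.cong inj₁ (size-≡ {f = ∣_∣} ≡.refl)
    from∘to (inj₂ (S , p)) = ≡.refl

  splitExponents₀ : ∀ {d} → Exponents d 0 ↔ Exponents (suc d) 0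
  splitExponents₀ {d} = mk↔ₛ′ to from to∘from (λ _ → ≡.refl)
    where
    to : Exponents d 0 → Exponents (suc d) 0
    to (e , p) = 0 ∷ e , p
    from : Exponents (suc d) 0 → Exponents d 0
    from (0 ∷ e , p) = e , p
    to∘from : ∀ e → to (from e) ≡ e
    to∘from (0 ∷ e , p) = ≡.refl

  splitExponents : ∀ {d k} → (Exponents d (suc k) ⊎ Exponents (suc d) k) ↔ Exponents (suc d) (suc k)
  splitExponents {d} {k} = mk↔ₛ′ to from to∘from from∘to
    where
    to : Exponents d (suc k) ⊎ Exponents (suc d) k → Exponents (suc d) (suc k)
    to (inj₁ (e , p))     = 0 ∷ e , p
    to (inj₂ (a ∷ e , p)) = suc a ∷ e , ≡.cong suc p
    from : Exponents (suc d) (suc k) → Exponents d (suc k) ⊎ Exponents (suc d) k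
    from (0 ∷ e , p)     = inj₁ (e , p)
    from (suc a ∷ e , p) = inj₂ (a ∷ e , ℕ.suc-injective p)
    to∘from : ∀ e → to (from e) ≡ e
    to∘from (0 ∷ e , p)     = ≡.refl
    to∘from (suc a ∷ e , p) = size-≡ {f = Vec.sum} ≡.refl
    from∘to : ∀ e → from (to e) ≡ e
    from∘to (inj₁ (e , p))     = ≡.refl
    from∘to (inj₂ (a ∷ e , p)) = ≡.cong inj₂ (size-≡ {f = Vec.sum} ≡.refl)

enumerateSubsets : ∀ n k → Fin (n C k) ↔ SubsetOfSize n k
enumerateSubsets zero zero = mk↔ₛ′ (λ _ → [] , ≡.refl) (λ _ → zero)
  (λ { ([] , ≡.refl) → ≡.refl }) (λ { zero → ≡.refl })
enumerateSubsets zero (suc k) = mk↔ₛ′ (λ ()) (λ { ([] , ()) }) (λ { ([] , ()) }) (λ ())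
enumerateSubsets (suc n) zero = splitSubset₀ ↔-∘ enumerateSubsets n zero
enumerateSubsets (suc n) (suc k) = splitSubset
  ↔-∘ ((enumerateSubsets n k ⊎-↔ enumerateSubsets n (suc k))
  ↔-∘ (+↔⊎ ↔-∘ Fin-cong (≡.sym (nCk+nC[k+1]≡[n+1]C[k+1] n k))))

enumerateExponents : ∀ d-1 k → Fin ((d-1 ℕ.+ k) C d-1) ↔ Exponents (suc d-1) k
enumerateExponents zero k =
  mk↔ₛ′ (λ _ → k ∷ [] , ℕ.+-identityʳ k) (λ _ → zero)
        (λ { (e ∷ [] , ≡.refl) → size-≡ {f = Vec.sum} (≡.cong (_∷ []) (ℕ.+-identityʳ e)) })
        (λ { zero → ≡.refl })
enumerateExponents (suc d-2) zero = splitExponents₀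
  ↔-∘ (enumerateExponents d-2 zero ↔-∘ Fin-cong (≡.trans (C-full (suc d-2)) (≡.sym (C-full d-2))))
  where
  C-full : ∀ n → (n ℕ.+ 0) C n ≡ 1
  C-full n = ≡.trans (≡.cong (_C n) (ℕ.+-identityʳ n)) (nCn≡1 n)
enumerateExponents (suc d-2) (suc k) = splitExponents
  ↔-∘ ((enumerateExponents d-2 (suc k) ⊎-↔ enumerateExponents (suc d-2) k)
  ↔-∘ (+↔⊎ ↔-∘ Fin-cong pascal))
  where
  open ≡.≡-Reasoning
  pascal : (suc d-2 ℕ.+ suc k) C suc d-2 ≡
           (d-2 ℕ.+ suc k) C d-2 ℕ.+ (suc d-2 ℕ.+ k) C suc d-2
  pascal = begin
    suc (d-2 ℕ.+ suc k) C suc d-2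
      ≡⟨ nCk+nC[k+1]≡[n+1]C[k+1] (d-2 ℕ.+ suc k) d-2 ⟨
    (d-2 ℕ.+ suc k) C d-2 ℕ.+ (d-2 ℕ.+ suc k) C suc d-2
      ≡⟨ ≡.cong (λ j → (d-2 ℕ.+ suc k) C d-2 ℕ.+ j C suc d-2) (ℕ.+-suc d-2 k) ⟩
    (d-2 ℕ.+ suc k) C d-2 ℕ.+ (suc d-2 ℕ.+ k) C suc d-2 ∎

module Geometry ⦃ ℝ : Reals ⦄ where

  open Reals ℝ
  open import Algebra.Properties.Semiring.Sum semiring
    using (sum; sum-syntax; sum-cong-≋; sum-remove; sum-replicate-zero)
  open import Algebra.Properties.Semiring.Exp semiring using (_^_)
  open import Algebra.Properties.CommutativeMonoid.Sum *-commutativeMonoid using () renaming (sum to product)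
  open import Data.Vec.Functional.Relation.Binary.Equality.Setoid setoid using (_≋_)
  open import Relation.Binary.Reasoning.Setoid setoid

  ℝ^ : ℕ → Set
  ℝ^ = Vector Carrier

  ⟨_,_⟩ : ∀ {d} → ℝ^ d → ℝ^ d → Carrier
  ⟨_,_⟩ {d} x y = ∑[ j < d ] (x j * y j)

  0ᵛ : ∀ {d} → ℝ^ d
  0ᵛ _ = 0#

  infixl 6 _+ᵛ_
  infixr 7 _·ᵛ_

  _+ᵛ_ : ∀ {d} → ℝ^ d → ℝ^ d → ℝ^ d
  (x +ᵛ y) j = x j + y j

  _·ᵛ_ : ∀ {d} → Carrier → ℝ^ d → ℝ^ d
  (t ·ᵛ x) j = t * x j

  combination : ∀ {n d} → Vector Carrier n → Vector (ℝ^ d) n → ℝ^ d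
  combination {n} t w j = ∑[ i < n ] (t i * w i j)

  LinearlyDependent : ∀ {n d} → Vector (ℝ^ d) n → Set
  LinearlyDependent {n} w =
    ∃[ c ] (∃[ i ] c i ≉ 0#) × combination {n} c w ≋ 0ᵛ

  LinearlyIndependent : ∀ {n d} → Vector (ℝ^ d) n → Set
  LinearlyIndependent w = ¬ LinearlyDependent w

  Distinct : ∀ {n d} → Vector (ℝ^ d) n → Set
  Distinct w = ∀ i j → w i ≋ w j → i ≡ j

  -- No d of the n vectors in ℝ^d, listed without repetition, are dependent.
  GeneralPosition : ∀ {n d} → Vector (ℝ^ d) n → Set
  GeneralPosition {n} {d} w =
    (ι : Fin d ↣ Fin n) → ¬ LinearlyDependent (w ∘ Injection.to ι)

  -- A p × q matrix is the family of its rows.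
  Matrix : ℕ → ℕ → Set
  Matrix p q = Vector (ℝ^ q) p

  -- r is the maximal number of linearly independent rows.
  HasRank : ∀ {p q} → Matrix p q → ℕ → Set
  HasRank {p} A r =
    (Σ (Fin r ↣ Fin p) λ ι → LinearlyIndependent (A ∘ Injection.to ι)) ×
    (∀ s (ι : Fin s ↣ Fin p) → LinearlyIndependent (A ∘ Injection.to ι) → s ℕ.≤ r)

  HasFullRank : ∀ {p q} → Matrix p q → Set
  HasFullRank {p} {q} A = HasRank A (p ℕ.⊓ q)

  Cone : ∀ {n d} → ℝ^ d → Vector (ℝ^ d) n → Pred (ℝ^ d) 0ℓ
  Cone {n} v w x = ∃[ t ] (∀ i → 0# < t i) × x ≋ v +ᵛ combination {n} t w

  ContainsLine : ∀ {d} → Pred (ℝ^ d) 0ℓ → Set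
  ContainsLine K = ∃[ p ] ∃[ u ] ¬ (u ≋ 0ᵛ) × (∀ t → K (p +ᵛ t ·ᵛ u))

  StrictlyConvex : ∀ {d} → Pred (ℝ^ d) 0ℓ → Set
  StrictlyConvex K = ¬ ContainsLine K

  minor : ∀ {d} → Matrix (suc d) (suc d) → Fin (suc d) → Fin (suc d) → Matrix d d
  minor M r c i = removeAt (removeAt M r i) c

  -- Laplace expansion along the last row.
  det : ∀ {d} → Matrix d d → Carrier
  det {zero}  M = 1#
  det {suc m} M =
    ∑[ j < suc m ] ((- 1#) ^ (m ℕ.+ toℕ j) * (M (fromℕ m) j * det (minor M (fromℕ m) j)))

  infixl 5 _∷ʳ_
  _∷ʳ_ : ∀ {A : Set} {m} → Vector A m → A → Vector A (suc m)
  _∷ʳ_ {m = m} xs x = insertAt xs (fromℕ m) x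

  det-cong : ∀ {d} {M N : Matrix d d} → (∀ i → M i ≋ N i) → det M ≈ det N
  det-cong {zero}  M≋N = refl
  det-cong {suc m} {M} {N} M≋N = sum-cong-≋ λ j →
    *-congˡ {x = (- 1#) ^ (m ℕ.+ toℕ j)} (*-cong (M≋N (fromℕ m) j)
      (det-cong {M = minor M (fromℕ m) j} {N = minor N (fromℕ m) j}
        λ i k → M≋N (punchIn (fromℕ m) i) (punchIn j k)))

  private
    unit : ∀ {d} → Fin d → ℝ^ d
    unit {suc d} j = insertAt 0ᵛ j 1#

    ⟨-,unit⟩ : ∀ {d} (x : ℝ^ d) j → ⟨ x , unit j ⟩ ≈ x j
    ⟨-,unit⟩ {suc d} x j = begin
      ⟨ x , unit j ⟩
        ≈⟨ sum-remove {i = j} (λ i → x i * unit j i) ⟩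
      x j * unit j j + sum (removeAt (λ i → x i * unit j i) j)
        ≈⟨ +-cong (*-congˡ (reflexive (insertAt-lookup 0ᵛ j 1#)))
                  (sum-cong-≋ λ i → trans (*-congˡ (reflexive (insertAt-punchIn 0ᵛ j 1# i))) (zeroʳ _)) ⟩
      x j * 1# + sum {d} (λ _ → 0#)
        ≈⟨ +-cong (*-identityʳ _) (sum-replicate-zero d) ⟩
      x j + 0#
        ≈⟨ +-identityʳ _ ⟩
      x j ∎

  crossProduct! : ∀ {m} (xs : Vector (ℝ^ (suc m)) m) →
                  ∃! _≋_ λ c → ∀ x → ⟨ c , x ⟩ ≈ det (xs ∷ʳ x)
  crossProduct! {m} xs = cofactor , spec , unique
    where
    cofactor : ℝ^ (suc m)
    cofactor j = (- 1#) ^ (m ℕ.+ toℕ j) * det (λ i → removeAt (xs i) j)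

    spec : ∀ x → ⟨ cofactor , x ⟩ ≈ det (xs ∷ʳ x)
    spec x = sum-cong-≋ λ j → begin
      (- 1#) ^ (m ℕ.+ toℕ j) * det (λ i → removeAt (xs i) j) * x j
        ≈⟨ *-assoc _ _ _ ⟩
      (- 1#) ^ (m ℕ.+ toℕ j) * (det (λ i → removeAt (xs i) j) * x j)
        ≈⟨ *-congˡ (*-comm _ _) ⟩
      (- 1#) ^ (m ℕ.+ toℕ j) * (x j * det (λ i → removeAt (xs i) j))
        ≈⟨ *-congˡ (*-cong
             (reflexive (≡.cong (λ y → y j) (insertAt-lookup xs (fromℕ m) x)))
             (det-cong λ i k → reflexive
               (≡.cong (λ y → y (punchIn j k)) (insertAt-punchIn xs (fromℕ m) x i)))) ⟨
      (- 1#) ^ (m ℕ.+ toℕ j) *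
        ((xs ∷ʳ x) (fromℕ m) j * det (minor (xs ∷ʳ x) (fromℕ m) j)) ∎

    unique : ∀ {c} → (∀ x → ⟨ c , x ⟩ ≈ det (xs ∷ʳ x)) → cofactor ≋ c
    unique {c} c-spec j = begin
      cofactor j               ≈⟨ ⟨-,unit⟩ cofactor j ⟨
      ⟨ cofactor , unit j ⟩    ≈⟨ spec (unit j) ⟩
      det (xs ∷ʳ unit j)       ≈⟨ c-spec (unit j) ⟨
      ⟨ c , unit j ⟩           ≈⟨ ⟨-,unit⟩ c j ⟩
      c j                      ∎

  crossProduct : ∀ {m} → Vector (ℝ^ (suc m)) m → ℝ^ (suc m)
  crossProduct xs = proj₁ (crossProduct! xs)

  monomial : ∀ {d k} → Exponents d k → ℝ^ d → Carrier
  monomial (e , _) x = product (λ j → x j ^ Vec.lookup e j)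

  veronese : ∀ {d k N} → Fin N ↔ Exponents d k → ℝ^ d → ℝ^ N
  veronese monomials x j = monomial (Inverse.to monomials j) x

  -- D*, for D a set of (dimension - 1) many generators taken in the given order.
  dual : ∀ {n m} → Vector (ℝ^ (suc m)) n → {D : Subset n} → Ordering m D → ℝ^ (suc m)
  dual w order = crossProduct (λ k → w (proj₁ (Inverse.to order k)))

  coneMatrix : ∀ {n m k p q} → Vector (ℝ^ (suc m)) n →
               Fin p ↔ SubsetOfSize n m →
               ((D : SubsetOfSize n m) → Ordering m (proj₁ D)) →
               Fin q ↔ Exponents (suc m) k →
               Matrix p q
  coneMatrix w diagonals order monomials r =
    veronese monomials (dual w (order (Inverse.to diagonals r)))

open Geometry public

{-# OPTIONS --safe #-}
module Submission where

open import Defs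
open import Data.Fin.Base using (Fin; zero; suc; toℕ; fromℕ; punchIn; punchOut; pinch)
open import Data.Fin.Properties using (any?; injective⇒≤; punchInᵢ≢i; punchIn-punchOut)
  renaming (_≟_ to _≟ᶠ_)
open import Data.Fin.Subset using (Subset; inside; outside; ∣_∣; _∈_; _∉_; _⊆_; ∁)
open import Data.Fin.Subset.Properties
  using (_∈?_; drop-there; drop-∷-⊆; p⊆q⇒∣p∣≤∣q∣; ∣∁p∣≡n∸∣p∣; x∈∁p⇒x∉p; x∉p⇒x∈∁p)
open import Data.Nat.Base as ℕ using (ℕ; zero; suc; _∸_; _≤_; s≤s)
import Data.Nat.Properties as ℕ
open import Data.Nat.Combinatorics using (_C_)
open import Data.Product.Base using (Σ; ∃-syntax; _×_; _,_; proj₁; proj₂)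
open import Data.Sum.Base using (_⊎_; inj₁; inj₂)
open import Data.Vec.Base as Vec using (Vec; []; _∷_; here; there)
open import Data.Vec.Functional using (Vector; insertAt; removeAt)
open import Data.Vec.Functional.Properties using (insertAt-lookup; insertAt-punchIn; insertAt-removeAt)
open import Data.Vec.Properties using (∷-injectiveʳ)
open import Data.Vec.Properties.WithK using ([]=-irrelevant)
open import Function.Base using (_∘_)
open import Function.Bundles using (_↔_; _↣_; Inverse; Injection; mk↣)
open import Function.Properties.Inverse using (↔-sym; ↔⇒↣)
open import Relation.Binary.Definitions using (tri<; tri≈; tri>)
open import Relation.Binary.Structures using (module IsStrictTotalOrder)
open import Relation.Binary.PropositionalEquality as ≡ using (_≡_; _≢_)
open import Relation.Nullary using (yes; no; contradiction; ¬?; _×-dec_)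
open import Relation.Nullary.Decidable using (decidable-stable)

-- Fix a generator w₀ and let D range over the diagonals not containing it; there
-- are as many of these as columns. The product of the n - d linear forms ⟨_, wᵢ⟩,
-- over the i outside D with i ≠ 0, vanishes at D′* iff D′ ⊈ D, since D′* is
-- orthogonal to wᵢ exactly for i ∈ D′; that is, iff D′ ≠ D. Evaluated at such a
-- product, a linear relation between the rows of these diagonals reduces to the
-- vanishing of one coefficient.

-- Indices, finite subsets and exponent vectors

-- Used as a view: matching its result against `refl` puts an index into the form in which
-- `insertAt` and `removeAt` at `p` can be evaluated.
punchInView : ∀ {n} (p i : Fin (suc n)) → i ≡ p ⊎ ∃[ k ] i ≡ punchIn p k
punchInView p i with p ≟ᶠ i
... | yes p≡i = inj₁ (≡.sym p≡i)
... | no  p≢i = inj₂ (punchOut p≢i , ≡.sym (punchIn-punchOut p≢i))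

-- (j , k) ↦ (punchIn j k , pinch k j) exchanges the two entries of the ordered
-- pair of distinct elements j and punchIn j k.
punchIn-pinch : ∀ {n} (j : Fin (suc n)) (k : Fin n) → punchIn (punchIn j k) (pinch k j) ≡ j
punchIn-pinch zero    zero    = ≡.refl
punchIn-pinch zero    (suc k) = ≡.refl
punchIn-pinch (suc j) zero    = ≡.refl
punchIn-pinch (suc j) (suc k) = ≡.cong suc (punchIn-pinch j k)

-- Both sides enumerate, in increasing order, the indices other than `j` and `punchIn j k`. Hence
-- deleting two columns in either order leaves the same minor.
punchIn-punchIn : ∀ {n} (j : Fin (suc (suc n))) (k : Fin (suc n)) (l : Fin n) →
                  punchIn (punchIn j k) (punchIn (pinch k j) l) ≡ punchIn j (punchIn k l)
punchIn-punchIn zero    zero    l       = ≡.refl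
punchIn-punchIn zero    (suc k) l       = ≡.refl
punchIn-punchIn (suc j) zero    l       = ≡.refl
punchIn-punchIn (suc j) (suc k) zero    = ≡.refl
punchIn-punchIn (suc j) (suc k) (suc l) = ≡.cong suc (punchIn-punchIn j k l)

Σ-≡ : ∀ {A : Set} {B : A → Set} → (∀ {a} (p q : B a) → p ≡ q) →
      {x y : Σ A B} → proj₁ x ≡ proj₁ y → x ≡ y
Σ-≡ irrelevant ≡.refl = ≡.cong (_ ,_) (irrelevant _ _)

⊆∧≥⇒≡ : ∀ {n} {p q : Subset n} → p ⊆ q → ∣ q ∣ ≤ ∣ p ∣ → p ≡ q
⊆∧≥⇒≡ {p = []}          {[]}          p⊆q q≤p = ≡.refl
⊆∧≥⇒≡ {p = outside ∷ p} {outside ∷ q} p⊆q q≤p = ≡.cong (outside ∷_) (⊆∧≥⇒≡ (drop-∷-⊆ p⊆q) q≤p)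
⊆∧≥⇒≡ {p = outside ∷ p} {inside  ∷ q} p⊆q q<p =
  contradiction (ℕ.<-≤-trans q<p (p⊆q⇒∣p∣≤∣q∣ (drop-∷-⊆ p⊆q))) (ℕ.<-irrefl ≡.refl)
⊆∧≥⇒≡ {p = inside  ∷ p} {outside ∷ q} p⊆q q≤p = contradiction (p⊆q here) λ ()
⊆∧≥⇒≡ {p = inside  ∷ p} {inside  ∷ q} p⊆q q≤p =
  ≡.cong (inside ∷_) (⊆∧≥⇒≡ (drop-∷-⊆ p⊆q) (ℕ.s≤s⁻¹ q≤p))

-- Without a witness `p` would be contained in `q`, and equal sizes would force equality.
∈-∉-witness : ∀ {n} {p q : Subset n} → ∣ p ∣ ≡ ∣ q ∣ → p ≢ q → ∃[ i ] i ∈ p × i ∉ q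
∈-∉-witness {p = p} {q} p≡q p≢q with any? (λ i → i ∈? p ×-dec ¬? (i ∈? q))
... | yes witness = witness
... | no  none    = contradiction (⊆∧≥⇒≡ p⊆q (ℕ.≤-reflexive (≡.sym p≡q))) p≢q
  where
  p⊆q : p ⊆ q
  p⊆q {i} i∈p = decidable-stable (i ∈? q) λ i∉q → none (i , i∈p , i∉q)

ordering-injective : ∀ {n m} {S : Subset n} (o : Ordering m S) {i j} →
                     proj₁ (Inverse.to o i) ≡ proj₁ (Inverse.to o j) → i ≡ j
ordering-injective o eq = Injection.injective (↔⇒↣ o) (Σ-≡ []=-irrelevant eq)

insertAt-injective : ∀ {A : Set} {m} {f : Vector A m} {p x} → (∀ {i j} → f i ≡ f j → i ≡ j) →
                     (∀ k → f k ≢ x) → ∀ {i j} → insertAt f p x i ≡ insertAt f p x j → i ≡ j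
insertAt-injective {f = f} {p} {x} f-inj f≢x {i} {j} eq with punchInView p i | punchInView p j
... | inj₁ ≡.refl       | inj₁ ≡.refl       = ≡.refl
... | inj₁ ≡.refl       | inj₂ (l , ≡.refl) = contradiction
  (≡.trans (≡.sym (insertAt-punchIn f p x l)) (≡.trans (≡.sym eq) (insertAt-lookup f p x))) (f≢x l)
... | inj₂ (k , ≡.refl) | inj₁ ≡.refl       = contradiction
  (≡.trans (≡.sym (insertAt-punchIn f p x k)) (≡.trans eq (insertAt-lookup f p x))) (f≢x k)
... | inj₂ (k , ≡.refl) | inj₂ (l , ≡.refl) = ≡.cong (punchIn p)
  (f-inj (≡.trans (≡.sym (insertAt-punchIn f p x k)) (≡.trans eq (insertAt-punchIn f p x l))))

map-insertAt : ∀ {A B : Set} {m} (g : A → B) (f : Vector A m) p x i →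
               insertAt (g ∘ f) p (g x) i ≡ g (insertAt f p x i)
map-insertAt g f p x i with punchInView p i
... | inj₁ ≡.refl       = ≡.trans (insertAt-lookup (g ∘ f) p (g x)) (≡.cong g (≡.sym (insertAt-lookup f p x)))
... | inj₂ (k , ≡.refl) = ≡.trans (insertAt-punchIn (g ∘ f) p (g x) k) (≡.cong g (≡.sym (insertAt-punchIn f p x k)))

sum-replicate₀ : ∀ d → Vec.sum (Vec.replicate d 0) ≡ 0
sum-replicate₀ zero    = ≡.refl
sum-replicate₀ (suc d) = sum-replicate₀ d

sum-increment : ∀ {d} (e : Vec ℕ d) j → Vec.sum (Vec.updateAt e j suc) ≡ suc (Vec.sum e)
sum-increment (a ∷ e) zero    = ≡.refl
sum-increment (a ∷ e) (suc j) = ≡.trans (≡.cong (a ℕ.+_) (sum-increment e j)) (ℕ.+-suc a (Vec.sum e))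

avoidingZero : ∀ {n k} → SubsetOfSize n k → SubsetOfSize (suc n) k
avoidingZero (S , p) = outside ∷ S , p

orderComplement : ∀ {n k} (S : SubsetOfSize n k) → Ordering (n ∸ k) (∁ (proj₁ S))
orderComplement {n} {k} (S , p) = ≡.subst (λ c → Ordering c (∁ S))
  (≡.trans (∣∁p∣≡n∸∣p∣ S) (≡.cong (n ∸_) p)) (orderSubset (∁ S))

module _ ⦃ ℝ : Reals ⦄ where

  open Reals ℝ hiding (zero)
  open IsStrictTotalOrder isStrictTotalOrder using (_≟_; compare; <-respˡ-≈; <-respʳ-≈; asym)
  open import Algebra.Properties.Semiring.Sum semiring
  open import Algebra.Properties.Semiring.Exp semiring using (_^_; ^-homo-*)
  open import Algebra.Properties.CommutativeMonoid.Sum *-commutativeMonoid using ()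
    renaming (sum to product)
  open import Algebra.Properties.Ring ring
    using (-‿distribˡ-*; -‿distribʳ-*; -1*x≈-x; -0#≈0#; -‿involutive; -‿+-comm)
  open import Algebra.Properties.CommutativeSemigroup *-commutativeSemigroup
    using (x∙yz≈y∙xz; x∙yz≈xz∙y; xy∙z≈xz∙y; interchange)
  open import Algebra.Properties.CommutativeSemigroup +-commutativeSemigroup using ()
    renaming (x∙yz≈y∙xz to x+yz≈y+xz)
  open import Data.Vec.Functional.Relation.Binary.Equality.Setoid setoid using (_≋_)
  open import Relation.Binary.Reasoning.Setoid setoid

  -- Field arithmetic and finite sums

  *-cancelˡ-0 : ∀ {x y} → x ≉ 0# → x * y ≈ 0# → y ≈ 0#
  *-cancelˡ-0 {x} {y} x≉0 xy≈0 with inverse x x≉0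
  ... | x⁻¹ , xx⁻¹≈1 = begin
    y              ≈⟨ *-identityˡ y ⟨
    1# * y         ≈⟨ *-congʳ xx⁻¹≈1 ⟨
    x * x⁻¹ * y    ≈⟨ *-congʳ (*-comm x x⁻¹) ⟩
    x⁻¹ * x * y    ≈⟨ *-assoc x⁻¹ x y ⟩
    x⁻¹ * (x * y)  ≈⟨ *-congˡ xy≈0 ⟩
    x⁻¹ * 0#       ≈⟨ zeroʳ x⁻¹ ⟩
    0#             ∎

  -- The order excludes characteristic 2: adding `x` to both sides of `x < 0` or `0 < x` turns it
  -- into the opposite inequality, because `x + x` is zero.
  x≈-x⇒x≈0 : ∀ {x} → x ≈ - x → x ≈ 0#
  x≈-x⇒x≈0 {x} x≈-x with compare x 0#
  ... | tri≈ _ x≈0 _ = x≈0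
  ... | tri< x<0 _ _ = contradiction
    (<-respʳ-≈ (+-identityˡ x) (<-respˡ-≈ x+x≈0 (+-monoˡ-< x x<0))) (asym x<0)
    where x+x≈0 = trans (+-congˡ x≈-x) (-‿inverseʳ x)
  ... | tri> _ _ 0<x = contradiction
    (<-respˡ-≈ (+-identityˡ x) (<-respʳ-≈ x+x≈0 (+-monoˡ-< x 0<x))) (asym 0<x)
    where x+x≈0 = trans (+-congˡ x≈-x) (-‿inverseʳ x)

  sum-zero : ∀ {n} {f : Vector Carrier n} → (∀ i → f i ≈ 0#) → sum f ≈ 0#
  sum-zero {n} f≈0 = trans (sum-cong-≋ f≈0) (sum-replicate-zero n)

  sum-single : ∀ {n} (f : Vector Carrier n) i → (∀ j → j ≢ i → f j ≈ 0#) → sum f ≈ f i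
  sum-single {suc n} f i f≈0 = begin
    sum f                     ≈⟨ sum-remove {i = i} f ⟩
    f i + sum (removeAt f i)  ≈⟨ +-congˡ (sum-zero λ k → f≈0 (punchIn i k) (punchInᵢ≢i i k)) ⟩
    f i + 0#                  ≈⟨ +-identityʳ (f i) ⟩
    f i                       ∎

  -- The index `(j , k)` encodes the ordered pair of distinct elements `j` and `punchIn j k`, and
  -- exchanging the entries permutes these pairs.
  ∑∑-swap : ∀ {n} (f : Fin (suc n) → Fin n → Carrier) →
            ∑[ j < suc n ] ∑[ k < n ] f j k ≈ ∑[ j < suc n ] ∑[ k < n ] f (punchIn j k) (pinch k j)
  ∑∑-swap {zero}  f = refl
  ∑∑-swap {suc n} f = begin
    A + ∑[ j < suc n ] (f (suc j) zero + ∑[ k < n ] f (suc j) (suc k))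
      ≈⟨ +-congˡ (∑-distrib-+ (λ j → f (suc j) zero) (λ j → ∑[ k < n ] f (suc j) (suc k))) ⟩
    A + (B + ∑[ j < suc n ] ∑[ k < n ] f (suc j) (suc k))
      ≈⟨ x+yz≈y+xz A B _ ⟩
    B + (A + ∑[ j < suc n ] ∑[ k < n ] f (suc j) (suc k))
      ≈⟨ +-congˡ (+-congˡ (∑∑-swap λ j k → f (suc j) (suc k))) ⟩
    B + (A + ∑[ j < suc n ] ∑[ k < n ] f (suc (punchIn j k)) (suc (pinch k j)))
      ≈⟨ +-congˡ (∑-distrib-+ (f zero) (λ j → ∑[ k < n ] f (suc (punchIn j k)) (suc (pinch k j)))) ⟨
    B + ∑[ j < suc n ] (f zero j + ∑[ k < n ] f (suc (punchIn j k)) (suc (pinch k j))) ∎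
    where
    -- `A` collects the pairs with first entry `zero`, `B` those with second entry `zero`. The
    -- exchange interchanges the two, and the remaining pairs fall to the induction.
    A = ∑[ k < suc n ] f zero k
    B = ∑[ j < suc n ] f (suc j) zero

  -- More vectors than dimensions are dependent

  elimination : ∀ {d n} → d ℕ.< n → (w : Vector (ℝ^ d) n) → LinearlyDependent w
  elimination {zero} (s≤s _) w = (λ _ → 1#) , (zero , 0≉1 ∘ sym) , λ ()
  elimination {suc d} {suc n} (s≤s d<n) w with any? (λ i → ¬? (w i zero ≟ 0#))
  ... | no  allZero with elimination (ℕ.m≤n⇒m≤1+n d<n) (λ i → w i ∘ suc)
  ...   | c , c≉0 , c-dep = c , c≉0 , λ where
    zero    → sum-zero λ i → trans
      (*-congˡ (decidable-stable (w i zero ≟ 0#) λ w≉0 → allZero (i , w≉0))) (zeroʳ (c i))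
    (suc j) → c-dep j
  elimination {suc d} {suc n} (s≤s d<n) w | yes (p , a≉0) = dependence
    where
    a = w p zero

    b : Vector Carrier n
    b k = w (punchIn p k) zero

    -- Scaling by the pivot entry `a` clears the first coordinate without division. Then `lift`
    -- turns coefficients for `u` into coefficients for `w`, collecting all multiples of `w p` at
    -- position `p`.
    u : Vector (ℝ^ (suc d)) n
    u k = a ·ᵛ w (punchIn p k) +ᵛ (- b k) ·ᵛ w p

    lift : Vector Carrier n → Vector Carrier (suc n)
    lift c = insertAt (λ k → c k * a) p (∑[ k < n ] (c k * - b k))

    lift-combination : ∀ c → combination (lift c) w ≋ combination c u
    lift-combination c j = begin
      combination (lift c) w j
        ≈⟨ sum-remove {i = p} (λ i → lift c i * w i j) ⟩
      lift c p * w p j + ∑[ k < n ] (lift c (punchIn p k) * w (punchIn p k) j)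
        ≈⟨ +-cong (*-congʳ (reflexive (insertAt-lookup (λ k → c k * a) p _)))
                  (sum-cong-≋ λ k → *-congʳ (reflexive (insertAt-punchIn (λ k → c k * a) p _ k))) ⟩
      ∑[ k < n ] (c k * - b k) * w p j + ∑[ k < n ] (c k * a * w (punchIn p k) j)
        ≈⟨ +-comm _ _ ⟩
      ∑[ k < n ] (c k * a * w (punchIn p k) j) + ∑[ k < n ] (c k * - b k) * w p j
        ≈⟨ +-congˡ (*-distribʳ-sum (w p j) (λ k → c k * - b k)) ⟩
      ∑[ k < n ] (c k * a * w (punchIn p k) j) + ∑[ k < n ] (c k * - b k * w p j)
        ≈⟨ ∑-distrib-+ (λ k → c k * a * w (punchIn p k) j) (λ k → c k * - b k * w p j) ⟨
      ∑[ k < n ] (c k * a * w (punchIn p k) j + c k * - b k * w p j)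
        ≈⟨ sum-cong-≋ (λ k → trans (+-cong (*-assoc (c k) a _) (*-assoc (c k) (- b k) _)) (sym (distribˡ (c k) _ _))) ⟩
      combination c u j ∎

    u-zero : ∀ k → u k zero ≈ 0#
    u-zero k = begin
      a * b k + - b k * a    ≈⟨ +-cong (*-comm a (b k)) (sym (-‿distribˡ-* (b k) a)) ⟩
      b k * a + - (b k * a)  ≈⟨ -‿inverseʳ (b k * a) ⟩
      0#                     ∎

    dependence : LinearlyDependent w
    dependence with elimination d<n (λ k → u k ∘ suc)
    ... | c , (i , c≉0) , c-dep = lift c , (punchIn p i , lift≉0) , λ j →
      trans (lift-combination c j) (u-dep j)
      where
      lift≉0 : lift c (punchIn p i) ≉ 0#
      lift≉0 ≈0 = c≉0 (*-cancelˡ-0 a≉0 (trans (*-comm a (c i))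
        (trans (reflexive (≡.sym (insertAt-punchIn (λ k → c k * a) p _ i))) ≈0)))

      u-dep : combination c u ≋ 0ᵛ
      u-dep zero    = sum-zero λ k → trans (*-congˡ (u-zero k)) (zeroʳ (c k))
      u-dep (suc j) = c-dep j

  -- Signed sums and the alternating property of the determinant

  ∑-neg : ∀ {n} (f : Vector Carrier n) → ∑[ i < n ] (- f i) ≈ - sum f
  ∑-neg {zero}  f = sym -0#≈0#
  ∑-neg {suc n} f = trans (+-congˡ (∑-neg (f ∘ suc))) (-‿+-comm _ _)

  ∑-bilinear : ∀ {m n} (x : Vector Carrier m) (y : Vector Carrier n) (A : Fin m → Fin n → Carrier) →
               ∑[ i < m ] (x i * ∑[ j < n ] (y j * A i j)) ≈ ∑[ j < n ] (y j * ∑[ i < m ] (x i * A i j))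
  ∑-bilinear {m} {n} x y A = begin
    ∑[ i < m ] (x i * ∑[ j < n ] (y j * A i j))
      ≈⟨ sum-cong-≋ (λ i → *-distribˡ-sum (x i) (λ j → y j * A i j)) ⟩
    ∑[ i < m ] ∑[ j < n ] (x i * (y j * A i j))
      ≈⟨ ∑-comm (λ i j → x i * (y j * A i j)) ⟩
    ∑[ j < n ] ∑[ i < m ] (x i * (y j * A i j))
      ≈⟨ sum-cong-≋ (λ j → sum-cong-≋ λ i → x∙yz≈y∙xz (x i) (y j) (A i j)) ⟩
    ∑[ j < n ] ∑[ i < m ] (y j * (x i * A i j))
      ≈⟨ sum-cong-≋ (λ j → *-distribˡ-sum (y j) (λ i → x i * A i j)) ⟨
    ∑[ j < n ] (y j * ∑[ i < m ] (x i * A i j)) ∎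

  -1≉0 : - 1# ≉ 0#
  -1≉0 -1≈0 = 0≉1 (begin
    0#        ≈⟨ -0#≈0# ⟨
    - 0#      ≈⟨ -‿cong -1≈0 ⟨
    - (- 1#)  ≈⟨ -‿involutive 1# ⟩
    1#        ∎)

  sign : ℕ → Carrier
  sign k = (- 1#) ^ k

  sign≉0 : ∀ k → sign k ≉ 0#
  sign≉0 zero    1≈0 = 0≉1 (sym 1≈0)
  sign≉0 (suc k) s≈0 = sign≉0 k (*-cancelˡ-0 -1≉0 s≈0)

  sign-suc : ∀ k → sign (suc k) ≈ - sign k
  sign-suc k = -1*x≈-x (sign k)

  -- Put `b = punchIn j k`. The positions `j` and `k` add up to `j + b - 1` if `j < b` and to
  -- `j + b` if `b < j`. Exchanging the pair switches the two cases and so the parity.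
  sign-flip : ∀ {n} (j : Fin (suc n)) (k : Fin n) →
              sign (toℕ j) * sign (toℕ k) ≈
              - (sign (toℕ (punchIn j k)) * sign (toℕ (pinch k j)))
  sign-flip {suc n} zero k = begin
    1# * sign (toℕ k)                 ≈⟨ *-comm _ _ ⟩
    sign (toℕ k) * 1#                 ≈⟨ -‿involutive _ ⟨
    - - (sign (toℕ k) * 1#)           ≈⟨ -‿cong (-‿distribˡ-* _ _) ⟩
    - (- sign (toℕ k) * 1#)           ≈⟨ -‿cong (*-congʳ (sign-suc (toℕ k))) ⟨
    - (sign (suc (toℕ k)) * 1#)       ∎
  sign-flip (suc j) zero = begin
    sign (suc (toℕ j)) * 1#           ≈⟨ *-congʳ (sign-suc (toℕ j)) ⟩
    - sign (toℕ j) * 1#               ≈⟨ -‿distribˡ-* _ _ ⟨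
    - (sign (toℕ j) * 1#)             ≈⟨ -‿cong (*-comm _ _) ⟩
    - (1# * sign (toℕ j))             ∎
  sign-flip (suc j) (suc k) = begin
    sign (suc (toℕ j)) * sign (suc (toℕ k))
      ≈⟨ interchange (- 1#) _ (- 1#) _ ⟩
    - 1# * - 1# * (sign (toℕ j) * sign (toℕ k))
      ≈⟨ *-congˡ (sign-flip j k) ⟩
    - 1# * - 1# * - (sign (toℕ (punchIn j k)) * sign (toℕ (pinch k j)))
      ≈⟨ -‿distribʳ-* _ _ ⟨
    - (- 1# * - 1# * (sign (toℕ (punchIn j k)) * sign (toℕ (pinch k j))))
      ≈⟨ -‿cong (interchange (- 1#) _ (- 1#) _) ⟨
    - (sign (suc (toℕ (punchIn j k))) * sign (suc (toℕ (pinch k j)))) ∎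

  module LastTwoRows (m : ℕ) where

    last penultimate : Fin (suc (suc m))
    last = fromℕ (suc m)
    penultimate = punchIn last (fromℕ m)

    other : Fin m → Fin (suc (suc m))
    other i = punchIn last (punchIn (fromℕ m) i)

    -- In a twofold Laplace expansion, `j` is the column chosen in the last row, and `k` is the
    -- position, once `j` is deleted, of the column `punchIn j k` chosen in the penultimate row.
    sign₂ : Fin (suc (suc m)) → Fin (suc m) → Carrier
    sign₂ j k = sign (suc m ℕ.+ toℕ j) * sign (m ℕ.+ toℕ k)

    sign₂-flip : ∀ j k → sign₂ j k ≈ - sign₂ (punchIn j k) (pinch k j)
    sign₂-flip j k = begin
      sign₂ j k
        ≈⟨ split (toℕ j) (toℕ k) ⟩
      sign (suc m) * sign m * (sign (toℕ j) * sign (toℕ k))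
        ≈⟨ *-congˡ (sign-flip j k) ⟩
      sign (suc m) * sign m * - (sign (toℕ (punchIn j k)) * sign (toℕ (pinch k j)))
        ≈⟨ -‿distribʳ-* _ _ ⟨
      - (sign (suc m) * sign m * (sign (toℕ (punchIn j k)) * sign (toℕ (pinch k j))))
        ≈⟨ -‿cong (split (toℕ (punchIn j k)) (toℕ (pinch k j))) ⟨
      - sign₂ (punchIn j k) (pinch k j) ∎
      where
      split : ∀ a b → sign (suc m ℕ.+ a) * sign (m ℕ.+ b) ≈ sign (suc m) * sign m * (sign a * sign b)
      split a b = trans (*-cong (^-homo-* (- 1#) (suc m) a) (^-homo-* (- 1#) m b)) (interchange _ _ _ _)

    minor₂ : Matrix (suc (suc m)) (suc (suc m)) → Fin (suc (suc m)) → Fin (suc m) → Matrix m m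
    minor₂ M j k i l = M (other i) (punchIn j (punchIn k l))

    term : Matrix (suc (suc m)) (suc (suc m)) → Fin (suc (suc m)) → Fin (suc m) → Carrier
    term M j k = sign₂ j k * (M last j * M penultimate (punchIn j k) * det (minor₂ M j k))

    det-expand₂ : ∀ M → det M ≈ ∑[ j < suc (suc m) ] ∑[ k < suc m ] term M j k
    det-expand₂ M = sum-cong-≋ λ j → begin
      sign (suc m ℕ.+ toℕ j) * (M last j * det (minor M last j))
        ≈⟨ *-assoc _ _ _ ⟨
      sign (suc m ℕ.+ toℕ j) * M last j * det (minor M last j)
        ≈⟨ *-distribˡ-sum _ (λ k → sign (m ℕ.+ toℕ k) *
             (M penultimate (punchIn j k) * det (minor₂ M j k))) ⟩
      ∑[ k < suc m ] (sign (suc m ℕ.+ toℕ j) * M last j *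
        (sign (m ℕ.+ toℕ k) * (M penultimate (punchIn j k) * det (minor₂ M j k))))
        ≈⟨ sum-cong-≋ (λ k → trans
             (interchange (sign (suc m ℕ.+ toℕ j)) (M last j) (sign (m ℕ.+ toℕ k)) _)
             (*-congˡ (sym (*-assoc (M last j) (M penultimate (punchIn j k)) (det (minor₂ M j k)))))) ⟩
      ∑[ k < suc m ] term M j k ∎

    -- Exchanging the two chosen columns in the twofold expansion keeps the complementary minor and
    -- flips every sign. The rowwise hypotheses also admit `N = M` when the last two rows agree,
    -- which gives `det M ≈ - det M`.
    det-swap : ∀ M N → M last ≋ N penultimate → M penultimate ≋ N last →
               (∀ i → M (other i) ≋ N (other i)) → det M ≈ - det N
    det-swap M N last≋ penultimate≋ other≋ = begin
      det M
        ≈⟨ det-expand₂ M ⟩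
      ∑[ j < suc (suc m) ] ∑[ k < suc m ] term M j k
        ≈⟨ ∑∑-swap (term M) ⟩
      ∑[ j < suc (suc m) ] ∑[ k < suc m ] term M (punchIn j k) (pinch k j)
        ≈⟨ sum-cong-≋ (λ j → sum-cong-≋ (term-flip j)) ⟩
      ∑[ j < suc (suc m) ] ∑[ k < suc m ] (- term N j k)
        ≈⟨ sum-cong-≋ (λ j → ∑-neg (term N j)) ⟩
      ∑[ j < suc (suc m) ] (- ∑[ k < suc m ] term N j k)
        ≈⟨ ∑-neg (λ j → ∑[ k < suc m ] term N j k) ⟩
      - ∑[ j < suc (suc m) ] ∑[ k < suc m ] term N j k
        ≈⟨ -‿cong (det-expand₂ N) ⟨
      - det N ∎
      where
      sign₂-flip′ : ∀ j k → sign₂ (punchIn j k) (pinch k j) ≈ - sign₂ j k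
      sign₂-flip′ j k = trans (sym (-‿involutive _)) (-‿cong (sym (sign₂-flip j k)))

      term-flip : ∀ j k → term M (punchIn j k) (pinch k j) ≈ - term N j k
      term-flip j k = begin
        sign₂ j′ k′ * (M last j′ * M penultimate (punchIn j′ k′) * det (minor₂ M j′ k′))
          ≈⟨ *-cong (sign₂-flip′ j k) (*-cong (*-cong (last≋ j′) penultimate-eq)
               (det-cong {M = minor₂ M j′ k′} {N = minor₂ N j k} minor-eq)) ⟩
        - sign₂ j k * (N penultimate j′ * N last j * det (minor₂ N j k))
          ≈⟨ *-congˡ (*-congʳ (*-comm _ _)) ⟩
        - sign₂ j k * (N last j * N penultimate j′ * det (minor₂ N j k))
          ≈⟨ -‿distribˡ-* _ _ ⟨
        - term N j k ∎
        where
        j′ = punchIn j k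
        k′ = pinch k j

        penultimate-eq : M penultimate (punchIn j′ k′) ≈ N last j
        penultimate-eq = trans (reflexive (≡.cong (M penultimate) (punchIn-pinch j k))) (penultimate≋ j)

        minor-eq : ∀ i → minor₂ M j′ k′ i ≋ minor₂ N j k i
        minor-eq i l = trans (reflexive (≡.cong (M (other i)) (punchIn-punchIn j k l))) (other≋ i _)

  Alternating : ℕ → Set
  Alternating d = (M : Matrix d d) → ∀ {i j} → i ≢ j → M i ≋ M j → det M ≈ 0#

  -- Neither copy is the row of expansion, so every minor still contains both.
  det-repeated : ∀ {m} → Alternating m → (M : Matrix (suc m) (suc m)) → ∀ {i j} → i ≢ j →
                 M (punchIn (fromℕ m) i) ≋ M (punchIn (fromℕ m) j) → det M ≈ 0#
  det-repeated {m} alternating M i≢j Mi≋Mj = sum-zero λ c →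
    trans (*-congˡ {x = sign (m ℕ.+ toℕ c)} (trans
            (*-congˡ {x = M (fromℕ m) c} (alternating (minor M (fromℕ m) c) i≢j (Mi≋Mj ∘ punchIn c)))
            (zeroʳ _)))
          (zeroʳ _)

  -- If the repeated row is not the penultimate one, exchanging the last two
  -- rows moves both copies above the row of expansion.
  det-last-repeated : ∀ {m} → Alternating m → (M : Matrix (suc m) (suc m)) → ∀ k →
                      M (fromℕ m) ≋ M (punchIn (fromℕ m) k) → det M ≈ 0#
  det-last-repeated {suc m} alternating M k eq with punchInView (fromℕ m) k
  ... | inj₁ ≡.refl = x≈-x⇒x≈0 (det-swap M M eq (sym ∘ eq) (λ i _ → refl))
    where open LastTwoRows m
  ... | inj₂ (k′ , ≡.refl) = begin
    det M    ≈⟨ det-swap M N (λ c → sym (N-penultimate c)) (λ c → sym (N-last c)) (λ i c → sym (N-other i c)) ⟩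
    - det N  ≈⟨ -‿cong (det-repeated alternating N (punchInᵢ≢i (fromℕ m) k′)
                  λ c → trans (N-other k′ c) (trans (sym (eq c)) (sym (N-penultimate c)))) ⟩
    - 0#     ≈⟨ -0#≈0# ⟩
    0#       ∎
    where
    open LastTwoRows m
    upper : Vector (ℝ^ (suc (suc m))) (suc m)
    upper = (M ∘ other) ∷ʳ M last
    N : Matrix (suc (suc m)) (suc (suc m))
    N = upper ∷ʳ M penultimate
    N-last : N last ≋ M penultimate
    N-last c = reflexive (≡.cong (λ y → y c) (insertAt-lookup upper last (M penultimate)))
    N-penultimate : N penultimate ≋ M last
    N-penultimate c = reflexive (≡.cong (λ y → y c) (≡.trans
      (insertAt-punchIn upper last (M penultimate) (fromℕ m))
      (insertAt-lookup (M ∘ other) (fromℕ m) (M last))))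
    N-other : ∀ i → N (other i) ≋ M (other i)
    N-other i c = reflexive (≡.cong (λ y → y c) (≡.trans
      (insertAt-punchIn upper last (M penultimate) (punchIn (fromℕ m) i))
      (insertAt-punchIn (M ∘ other) (fromℕ m) (M last) i)))

  det-alternating : ∀ d → Alternating d
  det-alternating (suc m) M {i} {j} i≢j eq with punchInView (fromℕ m) i | punchInView (fromℕ m) j
  ... | inj₁ ≡.refl       | inj₁ ≡.refl       = contradiction ≡.refl i≢j
  ... | inj₁ ≡.refl       | inj₂ (k , ≡.refl) = det-last-repeated (det-alternating m) M k eq
  ... | inj₂ (k , ≡.refl) | inj₁ ≡.refl       = det-last-repeated (det-alternating m) M k (sym ∘ eq)
  ... | inj₂ (k , ≡.refl) | inj₂ (l , ≡.refl) =
    det-repeated (det-alternating m) M (i≢j ∘ ≡.cong (punchIn (fromℕ m))) eq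

  -- Cross products and vanishing determinants

  ⟨crossProduct⟩ : ∀ {m} (xs : Vector (ℝ^ (suc m)) m) y → ⟨ crossProduct xs , y ⟩ ≈ det (xs ∷ʳ y)
  ⟨crossProduct⟩ xs = proj₁ (proj₂ (crossProduct! xs))

  -- The pairing is a determinant in which the row `xs k` occurs twice.
  crossProduct-⊥ : ∀ {m} (xs : Vector (ℝ^ (suc m)) m) k → ⟨ crossProduct xs , xs k ⟩ ≈ 0#
  crossProduct-⊥ {m} xs k = trans (⟨crossProduct⟩ xs (xs k))
    (det-last-repeated (det-alternating m) (xs ∷ʳ xs k) k λ c → reflexive (≡.cong (λ y → y c) (≡.trans
      (insertAt-lookup xs (fromℕ m) (xs k))
      (≡.sym (insertAt-punchIn xs (fromℕ m) (xs k) k)))))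

  dependent-extend : ∀ {n d} (w : Vector (ℝ^ d) (suc n)) p →
                     LinearlyDependent (removeAt w p) → LinearlyDependent w
  dependent-extend {n} w p (c , (i , c≉0) , c-dep) =
    insertAt c p 0# , (punchIn p i , λ ≈0 → c≉0 (trans (sym (c-punchIn i)) ≈0)) , λ j → begin
      combination (insertAt c p 0#) w j
        ≈⟨ sum-remove {i = p} (λ i → insertAt c p 0# i * w i j) ⟩
      insertAt c p 0# p * w p j + ∑[ k < n ] (insertAt c p 0# (punchIn p k) * w (punchIn p k) j)
        ≈⟨ +-cong (trans (*-congʳ (reflexive (insertAt-lookup c p 0#))) (zeroˡ _))
                  (sum-cong-≋ λ k → *-congʳ (c-punchIn k)) ⟩
      0# + combination c (removeAt w p) j
        ≈⟨ +-identityˡ _ ⟩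
      combination c (removeAt w p) j
        ≈⟨ c-dep j ⟩
      0# ∎
    where
    c-punchIn : ∀ k → insertAt c p 0# (punchIn p k) ≈ c k
    c-punchIn k = reflexive (insertAt-punchIn c p 0# k)

  -- Each dependency t j of the vectors without coordinate j combines them to a
  -- multiple of the unit vector e j. The m + 1 vectors t j in ℝ^ m are
  -- dependent, so some multiple is zero.
  minors-dependent : ∀ {m} (xs : Vector (ℝ^ (suc m)) m) →
                     (∀ j → LinearlyDependent (λ i → removeAt (xs i) j)) → LinearlyDependent xs
  minors-dependent {m} xs dependent = conclude (elimination (ℕ.n<1+n m) t)
    where
    t : Vector (ℝ^ m) (suc m)
    t j = proj₁ (dependent j)

    t-punchIn : ∀ j k → combination (t j) xs (punchIn j k) ≈ 0#
    t-punchIn j = proj₂ (proj₂ (dependent j))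

    conclude : LinearlyDependent t → LinearlyDependent xs
    conclude (s , (p , s≉0) , s-dep) = t p , proj₁ (proj₂ (dependent p)) , t-dep
      where
      pivot : s p * combination (t p) xs p ≈ 0#
      pivot = begin
        s p * combination (t p) xs p
          ≈⟨ sum-single (λ j → s j * combination (t j) xs p) p off-diagonal ⟨
        ∑[ j < suc m ] (s j * combination (t j) xs p)
          ≈⟨ sum-cong-≋ (λ j → *-congˡ {x = s j} (sum-cong-≋ λ i → *-comm (t j i) (xs i p))) ⟩
        ∑[ j < suc m ] (s j * ∑[ i < m ] (xs i p * t j i))
          ≈⟨ ∑-bilinear s (λ i → xs i p) t ⟩
        ∑[ i < m ] (xs i p * combination s t i)
          ≈⟨ sum-zero (λ i → trans (*-congˡ (s-dep i)) (zeroʳ (xs i p))) ⟩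
        0# ∎
        where
        off-diagonal : ∀ j → j ≢ p → s j * combination (t j) xs p ≈ 0#
        off-diagonal j j≢p with punchInView j p
        ... | inj₁ p≡j          = contradiction (≡.sym p≡j) j≢p
        ... | inj₂ (k , ≡.refl) = trans (*-congˡ (t-punchIn j k)) (zeroʳ _)

      t-dep : combination (t p) xs ≋ 0ᵛ
      t-dep j with punchInView p j
      ... | inj₁ ≡.refl       = *-cancelˡ-0 s≉0 pivot
      ... | inj₂ (k , ≡.refl) = t-punchIn p k

  -- With the coordinate `p` deleted, the `suc m` rows lie in dimension `m` and are dependent. The
  -- same combination of the full rows can be nonzero only at `p`; being orthogonal to `c`, whose
  -- entry at `p` is nonzero, it vanishes there too.
  orthogonal⇒dependent : ∀ {m} (M : Matrix (suc m) (suc m)) (c : ℝ^ (suc m)) j → c j ≉ 0# →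
                         (∀ i → ⟨ c , M i ⟩ ≈ 0#) → LinearlyDependent M
  orthogonal⇒dependent {m} M c p c≉0 c⊥M
    with elimination (ℕ.n<1+n m) (λ i → removeAt (M i) p)
  ... | s , s≉0 , s-dep = s , s≉0 , s-dep′
    where
    pivot : c p * combination s M p ≈ 0#
    pivot = begin
      c p * combination s M p
        ≈⟨ sum-single (λ j → c j * combination s M j) p off-diagonal ⟨
      ∑[ j < suc m ] (c j * combination s M j)
        ≈⟨ ∑-bilinear c s (λ j i → M i j) ⟩
      ∑[ i < suc m ] (s i * ⟨ c , M i ⟩)
        ≈⟨ sum-zero (λ i → trans (*-congˡ (c⊥M i)) (zeroʳ (s i))) ⟩
      0# ∎
      where
      off-diagonal : ∀ j → j ≢ p → c j * combination s M j ≈ 0#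
      off-diagonal j j≢p with punchInView p j
      ... | inj₁ j≡p          = contradiction j≡p j≢p
      ... | inj₂ (k , ≡.refl) = trans (*-congˡ (s-dep k)) (zeroʳ _)

    s-dep′ : combination s M ≋ 0ᵛ
    s-dep′ j with punchInView p j
    ... | inj₁ ≡.refl       = *-cancelˡ-0 c≉0 pivot
    ... | inj₂ (k , ≡.refl) = s-dep k

  -- If the cross product of the upper rows is nonzero, it is orthogonal to them and, as the
  -- determinant vanishes, also to the last row. If it is zero, all maximal minors of the upper rows
  -- vanish, and induction makes the upper rows themselves dependent.
  det≈0⇒dependent : ∀ {d} (M : Matrix d d) → det M ≈ 0# → LinearlyDependent M
  det≈0⇒dependent {zero}  M 1≈0 = contradiction (sym 1≈0) 0≉1
  det≈0⇒dependent {suc m} M det≈0 with any? (λ j → ¬? (crossProduct (removeAt M (fromℕ m)) j ≟ 0#))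
  ... | yes (j , c≉0) = orthogonal⇒dependent M (crossProduct xs) j c≉0 c⊥M
    where
    xs = removeAt M (fromℕ m)

    c⊥M : ∀ i → ⟨ crossProduct xs , M i ⟩ ≈ 0#
    c⊥M i with punchInView (fromℕ m) i
    ... | inj₁ ≡.refl       = begin
      ⟨ crossProduct xs , M (fromℕ m) ⟩  ≈⟨ ⟨crossProduct⟩ xs (M (fromℕ m)) ⟩
      det (xs ∷ʳ M (fromℕ m))            ≈⟨ det-cong {M = xs ∷ʳ M (fromℕ m)} {N = M} (λ i j →
                                              reflexive (≡.cong (λ y → y j) (insertAt-removeAt M (fromℕ m) i))) ⟩
      det M                              ≈⟨ det≈0 ⟩
      0#                                 ∎
    ... | inj₂ (k , ≡.refl) = crossProduct-⊥ xs k
  -- Entry `j` of the cross product is, up to sign, the minor of the upper rows without column `j`.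
  ... | no  c≈0 = dependent-extend M (fromℕ m) (minors-dependent (removeAt M (fromℕ m)) λ j →
    det≈0⇒dependent _ (*-cancelˡ-0 (sign≉0 (m ℕ.+ toℕ j))
      (decidable-stable (_ ≟ 0#) λ c≉0 → c≈0 (j , c≉0))))

  -- Products of linear forms on Veronese vectors

  product-zero : ∀ {n} {f : Vector Carrier n} i → f i ≈ 0# → product f ≈ 0#
  product-zero zero    f≈0 = trans (*-congʳ f≈0) (zeroˡ _)
  product-zero (suc i) f≈0 = trans (*-congˡ (product-zero i f≈0)) (zeroʳ _)

  product≉0 : ∀ {n} {f : Vector Carrier n} → (∀ i → f i ≉ 0#) → product f ≉ 0#
  product≉0 {zero}  f≉0 1≈0 = 0≉1 (sym 1≈0)
  product≉0 {suc n} f≉0 p≈0 = product≉0 (f≉0 ∘ suc) (*-cancelˡ-0 (f≉0 zero) p≈0)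

  -- This is `monomial` freed from the fixed degree, so that exponent vectors can be taken apart and
  -- incremented.
  power : ∀ {d} → ℝ^ d → Vec ℕ d → Carrier
  power x e = product (λ j → x j ^ Vec.lookup e j)

  power-replicate₀ : ∀ {d} (x : ℝ^ d) → power x (Vec.replicate d 0) ≈ 1#
  power-replicate₀ {zero}  x = refl
  power-replicate₀ {suc d} x = trans (*-identityˡ _) (power-replicate₀ (x ∘ suc))

  power-increment : ∀ {d} (x : ℝ^ d) e j → power x (Vec.updateAt e j suc) ≈ x j * power x e
  power-increment x (a ∷ e) zero    = *-assoc _ _ _
  power-increment x (a ∷ e) (suc j) =
    trans (*-congˡ (power-increment (x ∘ suc) e j)) (x∙yz≈y∙xz _ _ _)

  -- Expanding one linear form absorbs a coordinate of x r into the weight c r,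
  -- so the induction on k generalises over the weights.
  product-of-forms-vanishes :
    ∀ k {N d} (x : Vector (ℝ^ d) N) (c : Vector Carrier N) →
    ((e : Exponents d k) → ∑[ r < N ] (c r * monomial e (x r)) ≈ 0#) →
    (u : Vector (ℝ^ d) k) → ∑[ r < N ] (c r * product (λ i → ⟨ x r , u i ⟩)) ≈ 0#
  product-of-forms-vanishes zero {d = d} x c vanishes u = trans
    (sum-cong-≋ λ r → *-congˡ {x = c r} (sym (power-replicate₀ (x r))))
    (vanishes (Vec.replicate d 0 , sum-replicate₀ d))
  product-of-forms-vanishes (suc k) {N} {d} x c vanishes u = begin
    ∑[ r < N ] (c r * (⟨ x r , u zero ⟩ * P r))
      ≈⟨ sum-cong-≋ (λ r → trans (x∙yz≈xz∙y (c r) ⟨ x r , u zero ⟩ (P r))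
           (*-congˡ (sum-cong-≋ λ j → *-comm (x r j) (u zero j)))) ⟩
    ∑[ r < N ] (c r * P r * ∑[ j < d ] (u zero j * x r j))
      ≈⟨ ∑-bilinear (λ r → c r * P r) (u zero) x ⟩
    ∑[ j < d ] (u zero j * ∑[ r < N ] (c r * P r * x r j))
      ≈⟨ sum-zero (λ j → trans (*-congˡ (coefficient j)) (zeroʳ (u zero j))) ⟩
    0# ∎
    where
    P : Vector Carrier N
    P r = product (λ i → ⟨ x r , u (suc i) ⟩)

    coefficient : ∀ j → ∑[ r < N ] (c r * P r * x r j) ≈ 0#
    coefficient j = begin
      ∑[ r < N ] (c r * P r * x r j)
        ≈⟨ sum-cong-≋ (λ r → xy∙z≈xz∙y (c r) (P r) (x r j)) ⟩
      ∑[ r < N ] (c r * x r j * P r)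
        ≈⟨ product-of-forms-vanishes k x (λ r → c r * x r j) vanishes′ (u ∘ suc) ⟩
      0# ∎
      where
      vanishes′ : (e : Exponents d k) → ∑[ r < N ] (c r * x r j * monomial e (x r)) ≈ 0#
      vanishes′ (e , Σe≡k) = trans
        (sum-cong-≋ λ r → trans (*-assoc (c r) (x r j) _) (*-congˡ (sym (power-increment (x r) e j))))
        (vanishes (Vec.updateAt e j suc , ≡.trans (sum-increment e j) (≡.cong suc Σe≡k)))

  -- A dependency annihilates all monomials of degree `k`, hence also the product of the forms
  -- `u p`. That product vanishes at every point except `x p`, so the coefficient `c p` would have
  -- to be zero.
  veronese-independent :
    ∀ {k q N d} (monomials : Fin q ↔ Exponents d k)
    (x : Vector (ℝ^ d) N) (u : Fin N → Vector (ℝ^ d) k) →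
    (∀ r i → ⟨ x r , u r i ⟩ ≉ 0#) → (∀ r s → r ≢ s → ∃[ i ] ⟨ x r , u s i ⟩ ≈ 0#) →
    LinearlyIndependent (λ r → veronese monomials (x r))
  veronese-independent {k} {N = N} {d} monomials x u diagonal off-diagonal (c , (p , c≉0) , dep) =
    product≉0 (diagonal p) (*-cancelˡ-0 c≉0 (begin
      c p * form p
        ≈⟨ sum-single (λ r → c r * form r) p (λ r r≢p → let i , ≈0 = off-diagonal r p r≢p in
             trans (*-congˡ (product-zero i ≈0)) (zeroʳ (c r))) ⟨
      ∑[ r < N ] (c r * form r)
        ≈⟨ product-of-forms-vanishes k x c vanishes (u p) ⟩
      0# ∎))
    where
    form : Vector Carrier N
    form r = product (λ i → ⟨ x r , u p i ⟩)

    vanishes : (e : Exponents d k) → ∑[ r < N ] (c r * monomial e (x r)) ≈ 0#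
    -- A dependency is given column by column; since `monomials` is onto, each exponent vector
    -- occurs as a column.
    vanishes e = ≡.subst (λ e → ∑[ r < N ] (c r * monomial e (x r)) ≈ 0#)
      (Inverse.strictlyInverseˡ monomials e) (dep (Inverse.from monomials e))

  -- Which generators are orthogonal to D*

  dual-⊥ : ∀ {n m} (w : Vector (ℝ^ (suc m)) n) {D : Subset n} (o : Ordering m D) {i} →
           i ∈ D → ⟨ dual w o , w i ⟩ ≈ 0#
  dual-⊥ w o {i} i∈D = ≡.subst (λ i → ⟨ dual w o , w i ⟩ ≈ 0#)
    (≡.cong proj₁ (Inverse.strictlyInverseˡ o (i , i∈D)))
    (crossProduct-⊥ (w ∘ proj₁ ∘ Inverse.to o) (Inverse.from o (i , i∈D)))

  -- The pairing is the determinant of the generators in `D` followed by `w i`. Since `i ∉ D`, these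
  -- have distinct indices, and a zero determinant would contradict general position.
  dual-not-⊥ : ∀ {n m} (w : Vector (ℝ^ (suc m)) n) → GeneralPosition w →
               {D : Subset n} (o : Ordering m D) → ∀ {i} → i ∉ D → ⟨ dual w o , w i ⟩ ≉ 0#
  dual-not-⊥ {n} {m} w general {D} o {i} i∉D ≈0 =
    general (mk↣ {to = indices} (insertAt-injective {f = elements} {p = fromℕ m} (ordering-injective o) elements≢i))
      (det≈0⇒dependent (w ∘ indices) (begin
      det (w ∘ indices)             ≈⟨ det-cong {M = (w ∘ elements) ∷ʳ w i} {N = w ∘ indices} (λ r c →
                                         reflexive (≡.cong (λ y → y c) (map-insertAt w elements (fromℕ m) i r))) ⟨
      det ((w ∘ elements) ∷ʳ w i)   ≈⟨ ⟨crossProduct⟩ (w ∘ elements) (w i) ⟨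
      ⟨ dual w o , w i ⟩            ≈⟨ ≈0 ⟩
      0#                            ∎))
    where
    elements : Vector (Fin n) m
    elements = proj₁ ∘ Inverse.to o

    indices : Vector (Fin n) (suc m)
    indices = elements ∷ʳ i

    elements≢i : ∀ k → elements k ≢ i
    elements≢i k eq = i∉D (≡.subst (_∈ D) eq (proj₂ (Inverse.to o k)))

-- Full rank from the diagonals that avoid one generator

theorem2 : ⦃ ℝ : Reals ⦄ (d-1 n : ℕ) →
    suc d-1 ≤ n →
    (v : ℝ^ (suc d-1)) (w : Vector (ℝ^ (suc d-1)) n) →
    Distinct w →
    StrictlyConvex (Cone v w) →
    GeneralPosition w →
    (diagonals : Fin (n C d-1) ↔ SubsetOfSize n d-1) →
    (order : (D : SubsetOfSize n d-1) → Ordering d-1 (proj₁ D)) →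
    (monomials : Fin ((n ∸ 1) C d-1) ↔ Exponents (suc d-1) (n ∸ suc d-1)) →
    HasFullRank (coneMatrix w diagonals order monomials)
-- From here on `n` counts the generators other than the one at index `zero`, so `n C m` is both the
-- number of columns and the number of diagonals avoiding `zero`.
theorem2 m (suc n) (s≤s _) v w _ _ general diagonals order monomials =
  -- The injection `rows` shows that there are at most as many columns as rows, so full rank means
  -- the number of columns. More rows than that are dependent by `elimination`.
  ≡.subst (HasRank A) (≡.sym (ℕ.m≥n⇒m⊓n≡n (injective⇒≤ (Injection.injective rows))))
    ((rows , independent) , λ s ι indep → ℕ.≮⇒≥ λ q<s → indep (elimination q<s (A ∘ Injection.to ι)))
  where
  A = coneMatrix w diagonals order monomials

  S : Fin (n C m) → SubsetOfSize n m
  S = Inverse.to (enumerateSubsets n m)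

  S-injective : ∀ {r s} → proj₁ (S r) ≡ proj₁ (S s) → r ≡ s
  S-injective eq = Injection.injective (↔⇒↣ (enumerateSubsets n m)) (Σ-≡ ℕ.≡-irrelevant eq)

  rows : Fin (n C m) ↣ Fin (suc n C m)
  rows = mk↣ {to = λ r → Inverse.from diagonals (avoidingZero (S r))} λ eq →
    S-injective (∷-injectiveʳ (≡.cong proj₁ (Injection.injective (↔⇒↣ (↔-sym diagonals)) eq)))

  D : Fin (n C m) → SubsetOfSize (suc n) m
  D r = Inverse.to diagonals (Injection.to rows r)

  D≡ : ∀ r → proj₁ (D r) ≡ outside ∷ proj₁ (S r)
  D≡ r = ≡.cong proj₁ (Inverse.strictlyInverseˡ diagonals (avoidingZero (S r)))

  -- The complement is taken among the `n` nonzero indices, so its size `n ∸ m` is exactly the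
  -- degree of the monomials; `suc` converts its elements back to indices of generators.
  index : ∀ r → Fin (n ∸ m) → Fin n
  index r i = proj₁ (Inverse.to (orderComplement (S r)) i)

  index∉D : ∀ r i → suc (index r i) ∉ proj₁ (D r)
  index∉D r i i∈D = x∈∁p⇒x∉p (proj₂ (Inverse.to (orderComplement (S r)) i))
    (drop-there (≡.subst (suc (index r i) ∈_) (D≡ r) i∈D))

  -- An element of `S r` missing from `S s` gives one of the forms attached to `s`, and the
  -- corresponding generator lies in the diagonal `D r`.
  separated : ∀ r s → r ≢ s → ∃[ i ] suc (index s i) ∈ proj₁ (D r)
  separated r s r≢s =
    let j , j∈r , j∉s = ∈-∉-witness (≡.trans (proj₂ (S r)) (≡.sym (proj₂ (S s)))) (r≢s ∘ S-injective)
        o = orderComplement (S s)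
        j∈∁ = j , x∉p⇒x∈∁p j∉s
    in Inverse.from o j∈∁ , ≡.subst₂ (λ i D → suc i ∈ D)
         (≡.cong proj₁ (≡.sym (Inverse.strictlyInverseˡ o j∈∁))) (≡.sym (D≡ r)) (there j∈r)

  independent : LinearlyIndependent (A ∘ Injection.to rows)
  independent = veronese-independent monomials (λ r → dual w (order (D r))) (λ r i → w (suc (index r i)))
    (λ r i → dual-not-⊥ w general (order (D r)) (index∉D r i))
    (λ r s r≢s → let i , i∈D = separated r s r≢s in i , dual-⊥ w (order (D r)) i∈D)
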